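{- For all positive integers $m,n$ with $mn>1$, the cells of an $m\times n$ matrix can be assigned the distinct integers $1,\ldots,mn$ (each used exactly once) such that the $m$ row sums and the $n$ column sums are $m+n$ pairwise distinct numbers. -}

module Defs where

open import Data.Nat.Base using (ℕ; _*_; _≤_)
open import Data.Nat.Properties using (+-0-monoid)
open import Data.Fin.Base using (Fin)
open import Data.Product using (_×_; _,_; ∃!)
open import Data.Sum.Base using (_⊎_; [_,_])
open import Data.Vec.Functional using (Vector; transpose)
open import Relation.Binary.PropositionalEquality using (_≡_)
open import Algebra.Properties.Monoid.Sum +-0-monoid using (sum)

Matrix : ℕ → ℕ → Set
Matrix m n = Vector (Vector ℕ n) m

UsesEachOnce : ∀ {m n} → Matrix m n → Set
UsesEachOnce {m} {n} A =
  (∀ i j → 1 ≤ A i j × A i j ≤ m * n) ×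
  (∀ k → 1 ≤ k → k ≤ m * n → ∃! {A = Fin m × Fin n} _≡_ (λ (i , j) → A i j ≡ k))

rowSum : ∀ {m n} → Matrix m n → Fin m → ℕ
rowSum A i = sum (A i)

columnSum : ∀ {m n} → Matrix m n → Fin n → ℕ
columnSum A j = sum (transpose A j)

-- The m + n lines are indexed by the disjoint union, so injectivity of lineSum
-- also separates every row sum from every column sum.
lineSum : ∀ {m n} → Matrix m n → Fin m ⊎ Fin n → ℕ
lineSum A = [ rowSum A , columnSum A ]

{-# OPTIONS --safe #-}

-- By transposition assume m ≤ n and fill the matrix row by row.  The row sums
-- are then spaced n² apart, while the column sums are spaced m apart and spread
-- over less than n², so at most one row sum is also a column sum.  If it is the
-- sum of column j, interchange in the first row the entry of column j with a
-- neighbour.  Row sums do not change and column sums change by at most 1, so for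
-- m ≥ 3 they stay distinct, and the old sum of column j is no longer attained.
-- For m = 1 there is no coincidence; for m = 2 fill column by column instead:
-- column sums are then 3 modulo 4, and no row sum, being n² or n² + n, is.
module Submission where

open import Defs
open import Algebra.Properties.Semiring.Sum using (*-distribˡ-sum)
open import Data.Fin.Base using (Fin; zero; suc; toℕ; combine; remQuot; fromℕ<)
open import Data.Fin.Permutation as Permutation using (Permutation′; _⟨$⟩ʳ_; _⟨$⟩ˡ_; inverseˡ; inverseʳ; lift₀)
open import Data.Fin.Properties as Fin using (any?; combine-injective; combine-remQuot; toℕ-combine; toℕ-fromℕ<; toℕ-injective; toℕ<n; toℕ≤pred[n])
open import Data.Nat.Base using (ℕ; zero; suc; _+_; _*_; _<_; _≤_; z≤n; s≤s; z<s)
open import Data.Nat.Properties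
open import Data.Nat.Tactic.RingSolver using (solve-∀)
open import Data.Product using (Σ; ∃; _×_; _,_; proj₁; proj₂; swap)
open import Data.Sum.Base using (_⊎_; inj₁; inj₂)
open import Data.Sum.Properties using (inj₁-injective; inj₂-injective)
open import Data.Vec.Functional using (Vector; transpose)
open import Function.Base using (_∘_; const)
open import Function.Definitions using (Injective)
open import Relation.Binary.PropositionalEquality using (_≡_; _≢_; refl; sym; trans; cong; cong₂; subst; module ≡-Reasoning)
open import Relation.Nullary using (¬_; yes; no; contradiction)
open import Algebra.Properties.CommutativeMonoid.Sum +-0-commutativeMonoid using (sum; sum-cong-≗; sum-permute; ∑-distrib-+)

private
  variable
    m n : ℕ

-- Sums over `Fin n`.

sum-const : ∀ n x → sum {n} (const x) ≡ n * x
sum-const zero    x = refl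
sum-const (suc n) x = cong (x +_) (sum-const n x)

sum-shift : ∀ x (f : Vector ℕ n) → sum (λ i → x + f i) ≡ n * x + sum f
sum-shift {n} x f = trans (∑-distrib-+ (const x) f) (cong (_+ sum f) (sum-const n x))

sum-suc : (f : Vector ℕ n) → sum (suc ∘ f) ≡ n + sum f
sum-suc {n} f = trans (sum-shift 1 f) (cong (_+ sum f) (*-identityʳ n))

-- Gauss's formula, arranged to avoid subtraction and division. The left side is also the first
-- column sum of an `n` by 2 grid, the sum of the first `n` odd numbers.
sum-toℕ : ∀ n → n + 2 * sum {n} toℕ ≡ n * n
sum-toℕ zero    = refl
sum-toℕ (suc n) = begin
  suc n + 2 * sum {n} (suc ∘ toℕ)       ≡⟨ cong (λ s → suc n + 2 * s) (sum-suc {n} toℕ) ⟩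
  suc n + 2 * (n + sum {n} toℕ)         ≡⟨ rearranged n (sum {n} toℕ) ⟩
  suc n + n + (n + 2 * sum {n} toℕ)     ≡⟨ cong (suc n + n +_) (sum-toℕ n) ⟩
  suc n + n + n * n                     ≡⟨ square-suc n ⟩
  suc n * suc n                         ∎
  where
  open ≡-Reasoning
  rearranged : ∀ n s → suc n + 2 * (n + s) ≡ suc n + n + (n + 2 * s)
  rearranged = solve-∀
  square-suc : ∀ n → suc n + n + n * n ≡ suc n * suc n
  square-suc = solve-∀

-- Solutions and their transposes.

Solution : ℕ → ℕ → Set
Solution m n = Σ (Matrix m n) λ A → UsesEachOnce A × Injective _≡_ _≡_ (lineSum A)

lineSum-injective : (A : Matrix m n) →
  Injective _≡_ _≡_ (rowSum A) → Injective _≡_ _≡_ (columnSum A) →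
  (∀ i j → rowSum A i ≢ columnSum A j) → Injective _≡_ _≡_ (lineSum A)
lineSum-injective A row col row≢col {inj₁ i} {inj₁ k} eq = cong inj₁ (row eq)
lineSum-injective A row col row≢col {inj₁ i} {inj₂ j} eq = contradiction eq (row≢col i j)
lineSum-injective A row col row≢col {inj₂ j} {inj₁ i} eq = contradiction (sym eq) (row≢col i j)
lineSum-injective A row col row≢col {inj₂ j} {inj₂ l} eq = cong inj₂ (col eq)

transpose-solution : Solution m n → Solution n m
transpose-solution {m} {n} (A , (bounds , unique) , injective) =
  transpose A , (bounds′ , unique′) ,
  lineSum-injective (transpose A)
    (λ eq → inj₂-injective (injective {inj₂ _} {inj₂ _} eq))
    (λ eq → inj₁-injective (injective {inj₁ _} {inj₁ _} eq))
    (λ j i eq → inj₂≢inj₁ (injective {inj₂ j} {inj₁ i} eq))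
  where
  inj₂≢inj₁ : {i : Fin m} {j : Fin n} → inj₂ j ≢ inj₁ i
  inj₂≢inj₁ ()
  bounds′ : ∀ j i → 1 ≤ A i j × A i j ≤ n * m
  bounds′ j i = proj₁ (bounds i j) , ≤-trans (proj₂ (bounds i j)) (≤-reflexive (*-comm m n))
  unique′ : ∀ k → 1 ≤ k → k ≤ n * m → _
  unique′ k 1≤k k≤nm with (ij , Aij≡k , only) ← unique k 1≤k (≤-trans k≤nm (≤-reflexive (*-comm n m))) =
    swap ij , Aij≡k , λ {ji} eq → cong swap (only {swap ji} eq)

-- Row-by-row filling with a permuted first row.

firstRow : Permutation′ n → Fin m → Permutation′ n
firstRow ρ zero    = ρ
firstRow ρ (suc _) = Permutation.id

-- `combine` numbers the cells in row-major order from 0, hence the `suc`.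
grid : Permutation′ n → Matrix m n
grid ρ i j = suc (toℕ (combine i (firstRow ρ i ⟨$⟩ʳ j)))

grid-usesEachOnce : (ρ : Permutation′ n) → UsesEachOnce (grid {n} {m} ρ)
grid-usesEachOnce {n} {m} ρ = (λ i j → s≤s z≤n , toℕ<n (combine i _)) , unique
  where
  unique : ∀ k → 1 ≤ k → k ≤ m * n → _
  unique (suc k) _ k<mn = (i , firstRow ρ i ⟨$⟩ˡ j) , hit , λ {ij} → only {ij}
    where
    i = proj₁ (remQuot {m} n (fromℕ< k<mn))
    j = proj₂ (remQuot {m} n (fromℕ< k<mn))
    hit : grid ρ i (firstRow ρ i ⟨$⟩ˡ j) ≡ suc k
    hit = cong suc (trans (cong toℕ (trans (cong (combine i) (inverseʳ (firstRow ρ i)))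
                                           (combine-remQuot {m} n (fromℕ< k<mn))))
                          (toℕ-fromℕ< k<mn))
    only : ∀ {ij} → grid ρ (proj₁ ij) (proj₂ ij) ≡ suc k → (i , firstRow ρ i ⟨$⟩ˡ j) ≡ ij
    only {i′ , j′} eq
      -- Matching `refl` identifies the two rows, so `eq′` compares values of one and the same
      -- permutation.
      with refl , eq′ ← combine-injective i (firstRow ρ i ⟨$⟩ʳ (firstRow ρ i ⟨$⟩ˡ j)) i′ _
                          (toℕ-injective (suc-injective (trans hit (sym eq)))) =
      cong (i ,_) (trans (sym (inverseˡ (firstRow ρ i)))
                  (trans (cong (firstRow ρ i ⟨$⟩ˡ_) eq′) (inverseˡ (firstRow ρ i))))

-- Permuting entries inside a row keeps its sum, so `ρ` is absent from the right side: the row sums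
-- form a progression of step `n * n`.
rowSum-grid : (ρ : Permutation′ n) (i : Fin m) →
  rowSum (grid ρ) i ≡ n * n * toℕ i + (n + sum {n} toℕ)
rowSum-grid {n} ρ i = begin
  sum {n} (λ j → suc (toℕ (combine i (π ⟨$⟩ʳ j))))   ≡⟨ sum-permute {n} (λ j → suc (toℕ (combine i j))) π ⟨
  sum {n} (λ j → suc (toℕ (combine i j)))            ≡⟨ sum-suc {n} (λ j → toℕ (combine i j)) ⟩
  n + sum {n} (λ j → toℕ (combine i j))              ≡⟨ cong (n +_) (sum-cong-≗ {n} (toℕ-combine i)) ⟩
  n + sum {n} (λ j → n * toℕ i + toℕ j)              ≡⟨ cong (n +_) (sum-shift {n} (n * toℕ i) toℕ) ⟩
  n + (n * (n * toℕ i) + sum {n} toℕ)                ≡⟨ rearranged n (toℕ i) (sum {n} toℕ) ⟩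
  n * n * toℕ i + (n + sum {n} toℕ)                  ∎
  where
  open ≡-Reasoning
  π = firstRow ρ i
  rearranged : ∀ n i s → n + (n * (n * i) + s) ≡ n * n * i + (n + s)
  rearranged = solve-∀

-- Only the last bracket depends on the column: the first row contributes the image under `ρ`, each
-- of the other `m` rows contributes `toℕ j`.
columnSum-grid : ∀ m (ρ : Permutation′ n) (j : Fin n) →
  columnSum (grid {n} {suc m} ρ) j ≡
  suc m + n * sum {suc m} toℕ + (toℕ (ρ ⟨$⟩ʳ j) + m * toℕ j)
columnSum-grid {n} m ρ j = begin
  sum (λ i → suc (toℕ (combine i (π i))))        ≡⟨ sum-suc (λ i → toℕ (combine i (π i))) ⟩
  suc m + sum (λ i → toℕ (combine i (π i)))      ≡⟨ cong (suc m +_) (sum-cong-≗ (λ i → toℕ-combine i (π i))) ⟩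
  suc m + sum (λ i → n * toℕ i + toℕ (π i))      ≡⟨ cong (suc m +_) (∑-distrib-+ (λ i → n * toℕ i) (λ i → toℕ (π i))) ⟩
  suc m + (sum (λ i → n * toℕ {suc m} i) + sum (λ i → toℕ (π i)))
    ≡⟨ cong₂ (λ s t → suc m + (s + (toℕ (ρ ⟨$⟩ʳ j) + t)))
         (sym (*-distribˡ-sum +-*-semiring n (toℕ {suc m}))) (sum-const m (toℕ j)) ⟩
  suc m + (n * sum {suc m} toℕ + (toℕ (ρ ⟨$⟩ʳ j) + m * toℕ j))
    ≡⟨ +-assoc (suc m) _ _ ⟨
  suc m + n * sum {suc m} toℕ + (toℕ (ρ ⟨$⟩ʳ j) + m * toℕ j)  ∎
  where
  open ≡-Reasoning
  π : Fin (suc m) → Fin n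
  π i = firstRow ρ i ⟨$⟩ʳ j

rowSum-grid-injective : (ρ : Permutation′ (suc n)) → Injective _≡_ _≡_ (rowSum (grid {suc n} {m} ρ))
rowSum-grid-injective {n} ρ {i} {k} eq =
  toℕ-injective (*-cancelˡ-≡ (toℕ i) (toℕ k) (suc n * suc n)
    (+-cancelʳ-≡ _ _ _ (trans (sym (rowSum-grid ρ i)) (trans eq (rowSum-grid ρ k)))))

columnSum-grid-id-injective : ∀ m → Injective _≡_ _≡_ (columnSum (grid {n} {suc m} Permutation.id))
columnSum-grid-id-injective {n} m {j} {l} eq =
  toℕ-injective (*-cancelˡ-≡ (toℕ j) (toℕ l) (suc m)
    (+-cancelˡ-≡ (suc m + n * sum {suc m} toℕ) _ _
      (trans (sym (columnSum-grid m Permutation.id j)) (trans eq (columnSum-grid m Permutation.id l)))))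

-- A single row.

solution-1 : ∀ n → Solution 1 (2 + n)
solution-1 n = A , grid-usesEachOnce Permutation.id ,
  lineSum-injective A (rowSum-grid-injective Permutation.id) (columnSum-grid-id-injective 0) disjoint
  where
  A : Matrix 1 (2 + n)
  A = grid Permutation.id
  disjoint : ∀ i j → rowSum A i ≢ columnSum A j
  disjoint zero j eq = <-irrefl (sym eq) (begin-strict
    columnSum A j                                       ≡⟨ +-identityʳ _ ⟩
    A zero j                                            ≤⟨ toℕ<n (combine {1} zero j) ⟩
    1 * (2 + n)                                         ≡⟨ *-identityˡ (2 + n) ⟩
    -- With at least two columns the index 1 occurs in the sum, which is therefore positive.
    2 + n                                               <⟨ m<m+n (2 + n) z<s ⟩
    2 + n + sum {2 + n} toℕ                             ≤⟨ m≤n+m _ _ ⟩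
    (2 + n) * (2 + n) * 0 + (2 + n + sum {2 + n} toℕ)   ≡⟨ rowSum-grid {2 + n} {1} Permutation.id zero ⟨
    rowSum A zero                                       ∎)
    where open ≤-Reasoning

-- Two rows, and squares modulo 4.

halve : ∀ n → ∃ λ k → n ≡ 2 * k ⊎ n ≡ suc (2 * k)
halve zero    = 0 , inj₁ refl
halve (suc n) with halve n
... | k , inj₁ refl = k , inj₂ refl
... | k , inj₂ refl = suc k , inj₁ (sym (*-suc 2 k))

3+4*-odd : ∀ i → 3 + 4 * i ≡ suc (2 * suc (2 * i))
3+4*-odd = solve-∀

-- An even square has the wrong parity. An odd square is 1 plus a multiple of 4, whereas the right
-- side is 1 plus twice an odd number.
square≢3mod4 : ∀ n i → n * n ≢ 3 + 4 * i
square≢3mod4 n i eq with halve n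
... | k , inj₁ refl = even≢odd (2 * k * k) (suc (2 * i)) (trans (lhs k) (trans eq (3+4*-odd i)))
  where
  lhs : ∀ k → 2 * (2 * k * k) ≡ 2 * k * (2 * k)
  lhs = solve-∀
... | k , inj₂ refl = even≢odd (k * k + k) i
  (*-cancelˡ-≡ _ _ 2 (suc-injective (trans (lhs k) (trans eq (3+4*-odd i)))))
  where
  lhs : ∀ k → suc (2 * (2 * (k * k + k))) ≡ suc (2 * k) * suc (2 * k)
  lhs = solve-∀

solution-2 : ∀ n → Solution 2 (suc n)
solution-2 n = transpose-solution (A , grid-usesEachOnce Permutation.id ,
  lineSum-injective A (rowSum-grid-injective Permutation.id) (columnSum-grid-id-injective n) disjoint)
  where
  A : Matrix (suc n) 2
  A = grid Permutation.id
  S = sum {suc n} toℕ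
  row : ∀ i → rowSum A i ≡ 3 + 4 * toℕ i
  row i = trans (rowSum-grid Permutation.id i) (+-comm (4 * toℕ i) 3)
  disjoint : ∀ i j → rowSum A i ≢ columnSum A j
  -- The first column holds the odd numbers, so its sum is a square.
  disjoint i zero eq = square≢3mod4 (suc n) (toℕ i) (begin
    suc n * suc n                  ≡⟨ sum-toℕ (suc n) ⟨
    suc n + 2 * S                  ≡⟨ rearranged n S ⟩
    suc n + 2 * S + (0 + n * 0)    ≡⟨ columnSum-grid n Permutation.id zero ⟨
    columnSum A zero               ≡⟨ eq ⟨
    rowSum A i                     ≡⟨ row i ⟩
    3 + 4 * toℕ i                  ∎)
    where
    open ≡-Reasoning
    rearranged : ∀ n s → suc n + 2 * s ≡ suc n + 2 * s + (0 + n * 0)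
    rearranged = solve-∀
  -- The second column holds the even numbers, so parity suffices.
  disjoint i (suc zero) eq = even≢odd (suc n + S) (suc (2 * toℕ i)) (begin
    2 * (suc n + S)                ≡⟨ lhs n S ⟩
    suc n + 2 * S + (1 + n * 1)    ≡⟨ columnSum-grid n Permutation.id (suc zero) ⟨
    columnSum A (suc zero)         ≡⟨ eq ⟨
    rowSum A i                     ≡⟨ row i ⟩
    3 + 4 * toℕ i                  ≡⟨ 3+4*-odd (toℕ i) ⟩
    suc (2 * suc (2 * toℕ i))      ∎)
    where
    open ≡-Reasoning
    lhs : ∀ n s → 2 * (suc n + s) ≡ suc n + 2 * s + (1 + n * 1)
    lhs = solve-∀
  
-- Permutations displacing every index by at most one.

NearIdentity : Permutation′ n → Set
NearIdentity ρ = ∀ j → toℕ (ρ ⟨$⟩ʳ j) ≤ suc (toℕ j) × toℕ j ≤ suc (toℕ (ρ ⟨$⟩ʳ j))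

id-nearIdentity : NearIdentity {n} Permutation.id
id-nearIdentity j = n≤1+n _ , n≤1+n _

swap₀₁ : Permutation′ (2 + n)
swap₀₁ = Permutation.swap Permutation.id

swap₀₁-nearIdentity : NearIdentity (swap₀₁ {n})
swap₀₁-nearIdentity zero          = s≤s z≤n , z≤n
swap₀₁-nearIdentity (suc zero)    = z≤n , s≤s z≤n
swap₀₁-nearIdentity (suc (suc j)) = n≤1+n _ , n≤1+n _

lift₀-nearIdentity : (ρ : Permutation′ n) → NearIdentity ρ → NearIdentity (lift₀ ρ)
lift₀-nearIdentity ρ near zero    = z≤n , z≤n
lift₀-nearIdentity ρ near (suc j) = s≤s (proj₁ (near j)) , s≤s (proj₂ (near j))

-- The witness exchanges `j` with its successor, or with its predecessor if `j` is the last index;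
-- `lift₀` carries the swap of 0 and 1 to the right place.
nearIdentity-moving : (j : Fin (2 + n)) → Σ (Permutation′ (2 + n)) λ ρ → NearIdentity ρ × ρ ⟨$⟩ʳ j ≢ j
nearIdentity-moving         zero       = swap₀₁ , swap₀₁-nearIdentity , λ ()
nearIdentity-moving {zero}  (suc zero) = swap₀₁ , swap₀₁-nearIdentity , λ ()
nearIdentity-moving {suc n} (suc j) with (ρ , near , moves) ← nearIdentity-moving j =
  lift₀ ρ , lift₀-nearIdentity ρ near , λ eq → moves (Fin.suc-injective eq)

-- Separation in arithmetic progressions.

-- Distinct multiples of `3 + m` differ by at least 3, which a slack of 2 cannot bridge.
multiples-apart : ∀ m x y → (3 + m) * x ≤ 2 + (3 + m) * y → x ≤ y
multiples-apart m x y le = ≮⇒≥ λ y<x → <-irrefl refl (begin-strict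
  (3 + m) * x        ≤⟨ le ⟩
  2 + (3 + m) * y    <⟨ +-monoˡ-< ((3 + m) * y) (m≤m+n 3 m) ⟩
  3 + m + (3 + m) * y ≡⟨ *-suc (3 + m) y ⟨
  (3 + m) * suc y    ≤⟨ *-monoʳ-≤ (3 + m) y<x ⟩
  (3 + m) * x        ∎)
  where open ≤-Reasoning

-- A progression of step `d` has at most one term among the `d` consecutive numbers starting at `c`.
-- Applied to row sums, this leaves only one row that can meet a column sum.
window-unique : ∀ d {c t u v} x y → d * x + t ≡ c + u → d * y + t ≡ c + v → u < d → v < d → x ≡ y
window-unique d {c} {t} x y p q u<d v<d =
  ≤-antisym (below x y p q u<d) (below y x q p v<d)
  where
  open ≤-Reasoning
  below : ∀ x y {u v} → d * x + t ≡ c + u → d * y + t ≡ c + v → u < d → x ≤ y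
  below x y {u} {v} p q u<d = ≮⇒≥ λ y<x → <-irrefl refl (begin-strict
    c + u              <⟨ +-monoʳ-< c u<d ⟩
    c + d              ≤⟨ +-monoˡ-≤ d (m≤m+n c v) ⟩
    c + v + d          ≡⟨ cong (_+ d) q ⟨
    d * y + t + d      ≡⟨ rearranged d y t ⟩
    d * suc y + t      ≤⟨ +-monoˡ-≤ t (*-monoʳ-≤ d y<x) ⟩
    d * x + t          ≡⟨ p ⟩
    c + u              ∎)
    where
    rearranged : ∀ d y t → d * y + t + d ≡ d * suc y + t
    rearranged = solve-∀

-- At least three rows, and no fewer columns than rows.

module _ (m n : ℕ) (m≤n : 3 + m ≤ 2 + n) where

  private
    M N : ℕ
    M = 3 + m
    N = 2 + n

  -- The column-dependent part of `columnSum-grid`; for the identity it equals `M * toℕ j`.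
  offset : Permutation′ N → Fin N → ℕ
  offset ρ j = toℕ (ρ ⟨$⟩ʳ j) + (2 + m) * toℕ j

  offset≤ : ∀ ρ → NearIdentity ρ → ∀ j → offset ρ j ≤ 1 + M * toℕ j
  offset≤ ρ near j = +-monoˡ-≤ ((2 + m) * toℕ j) (proj₁ (near j))

  offset≥ : ∀ ρ → NearIdentity ρ → ∀ j → M * toℕ j ≤ 1 + offset ρ j
  offset≥ ρ near j = +-monoˡ-≤ ((2 + m) * toℕ j) (proj₂ (near j))

  offset< : ∀ ρ → NearIdentity ρ → ∀ j → offset ρ j < N * N
  offset< ρ near j = begin-strict
    offset ρ j          ≤⟨ offset≤ ρ near j ⟩
    -- Here `M ≤ N` keeps the column sums inside a window of length `N * N`; the last column has
    -- index `suc n`.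
    1 + M * toℕ j       ≤⟨ s≤s (*-mono-≤ m≤n (toℕ≤pred[n] j)) ⟩
    1 + N * suc n       <⟨ +-monoˡ-< (N * suc n) (s≤s (s≤s (z≤n {n}))) ⟩
    N + N * suc n       ≡⟨ *-suc N (suc n) ⟨
    N * N               ∎
    where open ≤-Reasoning

  -- Each offset is within 1 of its multiple of `M`, so equal offsets force multiples within 2. With
  -- `ρ` and `σ` equal this separates columns of one grid; with one of them the identity it compares
  -- columns before and after the exchange.
  offset-coincide : ∀ ρ σ → NearIdentity ρ → NearIdentity σ → ∀ j l → offset ρ j ≡ offset σ l → j ≡ l
  offset-coincide ρ σ nearρ nearσ j l eq = toℕ-injective
    (≤-antisym (below ρ σ nearρ nearσ j l eq) (below σ ρ nearσ nearρ l j (sym eq)))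
    where
    open ≤-Reasoning
    below : ∀ ρ σ → NearIdentity ρ → NearIdentity σ → ∀ j l → offset ρ j ≡ offset σ l → toℕ j ≤ toℕ l
    below ρ σ nearρ nearσ j l eq = multiples-apart m (toℕ j) (toℕ l) (begin
      M * toℕ j          ≤⟨ offset≥ ρ nearρ j ⟩
      1 + offset ρ j     ≡⟨ cong suc eq ⟩
      1 + offset σ l     ≤⟨ s≤s (offset≤ σ nearσ l) ⟩
      2 + M * toℕ l      ∎)

  Collides : Permutation′ N → Fin M → Fin N → Set
  Collides ρ i j = N * N * toℕ i + (N + sum {N} toℕ) ≡ M + N * sum {M} toℕ + offset ρ j

  collisionFree-solution : ∀ ρ → NearIdentity ρ → (∀ i j → ¬ Collides ρ i j) → Solution M N
  collisionFree-solution ρ near free = grid ρ , grid-usesEachOnce ρ ,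
    lineSum-injective (grid ρ) (rowSum-grid-injective ρ)
      (λ {j} {l} eq → offset-coincide ρ ρ near near j l
        (+-cancelˡ-≡ (M + N * sum {M} toℕ) _ _ (trans (sym (columnSum-grid (2 + m) ρ j)) (trans eq (columnSum-grid (2 + m) ρ l)))))
      (λ i j eq → free i j (trans (sym (rowSum-grid ρ i)) (trans eq (columnSum-grid (2 + m) ρ j))))

  -- By `window-unique` a new collision would involve the same row, so the new sum of column `l`
  -- would be the old sum of column `j`. Then `l` is `j` by `offset-coincide`, and `ρ` would fix
  -- `j`.
  collision-resolved : ∀ ρ → NearIdentity ρ → ∀ i j → Collides Permutation.id i j →
    ρ ⟨$⟩ʳ j ≢ j → ∀ k l → ¬ Collides ρ k l
  collision-resolved ρ near i j collision moves k l collision′ with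
    refl ← toℕ-injective (window-unique (N * N) {c = M + N * sum {M} toℕ} (toℕ i) (toℕ k) collision collision′
      (offset< Permutation.id id-nearIdentity j) (offset< ρ near l))
    = moves (toℕ-injective (+-cancelʳ-≡ ((2 + m) * toℕ j) _ _ (sym fixed)))
    where
    same : offset Permutation.id j ≡ offset ρ l
    same = +-cancelˡ-≡ (M + N * sum {M} toℕ) _ _ (trans (sym collision) collision′)
    fixed : offset Permutation.id j ≡ offset ρ j
    fixed = trans same (cong (offset ρ) (sym (offset-coincide Permutation.id ρ id-nearIdentity near j l same)))

  solution-≥3 : Solution M N
  solution-≥3 with any? (λ i → any? (λ j →
    N * N * toℕ i + (N + sum {N} toℕ) ≟ M + N * sum {M} toℕ + offset Permutation.id j))
  ... | no none = collisionFree-solution Permutation.id id-nearIdentity λ i j c → none (i , j , c)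
  ... | yes (i , j , collision) with (ρ , near , moves) ← nearIdentity-moving j =
    collisionFree-solution ρ near (collision-resolved ρ near i j collision moves)

-- Case distinction and reduction to `m ≤ n`.

solution-≤ : ∀ m n → 0 < m → 1 < m * n → m ≤ n → Solution m n
solution-≤ 1 1             _ (s≤s ()) _
solution-≤ 1 (suc (suc n)) _ _ _  = solution-1 n
solution-≤ 2 (suc n)       _ _ _  = solution-2 n
solution-≤ (suc (suc (suc m))) (suc (suc n)) _ _ m≤n = solution-≥3 m n m≤n
solution-≤ (suc (suc (suc m))) 1 _ _ (s≤s ())

lemma5p1 : (m n : ℕ) → 0 < m → 0 < n → 1 < m * n →
    Σ (Matrix m n) λ A → UsesEachOnce A × Injective _≡_ _≡_ (lineSum A)
lemma5p1 m n 0<m 0<n 1<mn with ≤-total m n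
... | inj₁ m≤n = solution-≤ m n 0<m 1<mn m≤n
... | inj₂ n≤m = transpose-solution (solution-≤ n m 0<n (subst (1 <_) (*-comm m n) 1<mn) n≤m)
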